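{- Let $G$ be a graph with $\chi(G)\ge 4$. If $G$ contains no subgraph isomorphic to $K_4$, then $G$ contains a cycle with at least four chords.
   Context: All graphs are finite and simple. $\chi(G)$ is the chromatic number of $G$. A chord of a cycle $C$ in $G$ is an edge of $G$ joining two vertices of $C$ that are not consecutive on $C$. -}

module Defs where

open import Data.Fin.Base using (Fin; toℕ; finToFun; funToFin; _<_)
open import Data.Fin.Properties using (_≟_; any?; all?; finToFun-funToFin)
open import Data.Nat.Base using (ℕ; zero; suc; _≤_; z≤n; s≤s)
open import Data.Product.Base using (∃; ∃-syntax; _×_; _,_; proj₁; proj₂)
open import Data.Sum.Base using (_⊎_)
open import Function.Base using (_∘_; id)
open import Function.Definitions using (Injective)
open import Level using (0ℓ)
open import Relation.Binary.Core using (Rel)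
open import Relation.Binary.Definitions using (Decidable; Irreflexive; Symmetric)
open import Relation.Binary.PropositionalEquality
  using (_≡_; _≢_; sym; trans)
open import Relation.Nullary.Decidable
  using (Dec; yes; no; map′; ¬?; _→-dec_)
open import Relation.Nullary.Negation using (¬_; contradiction)
import Relation.Unary as U

-- Finite simple graphs on n vertices. Decidability of adjacency makes the
-- chromatic number computable; classically it is no restriction.
record Graph (n : ℕ) : Set₁ where
  field
    Adj       : Rel (Fin n) 0ℓ
    adj?      : Decidable Adj
    symmetric : Symmetric Adj
    loopless  : Irreflexive _≡_ Adj

open Graph public

K : ∀ n → Graph n
K n = record
  { Adj       = _≢_
  ; adj?      = λ u v → ¬? (u ≟ v)
  ; symmetric = λ u≢v → u≢v ∘ sym
  ; loopless  = λ u≡v u≢v → u≢v u≡v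
  }

-- The subgraph isomorphic to H consists of the image of f and the images of
-- the edges of H; it need not be induced.
ContainsSubgraph : ∀ {m n} → Graph n → Graph m → Set
ContainsSubgraph {m} {n} G H =
  ∃[ f ] Injective {A = Fin m} {B = Fin n} _≡_ _≡_ f
       × (∀ u v → Adj H u v → Adj G (f u) (f v))

IsProperColouring : ∀ {n k} → Graph n → (Fin n → Fin k) → Set
IsProperColouring G c = ∀ u v → Adj G u v → c u ≢ c v

Colourable : ∀ {n} → Graph n → ℕ → Set
Colourable {n} G k = ∃[ c ] IsProperColouring {n} {k} G c

IsLeast : U.Pred ℕ 0ℓ → ℕ → Set
IsLeast P k = P k × (∀ m → P m → k ≤ m)

least : ∀ {P : U.Pred ℕ 0ℓ} → U.Decidable P → ∀ n → P n → ∃ (IsLeast P)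
least P? n pn with P? 0
... | yes p0 = 0 , p0 , λ _ _ → z≤n
least P? zero    pn | no ¬p0 = contradiction pn ¬p0
least P? (suc n) pn | no ¬p0 with least (P? ∘ suc) n pn
... | k , pk , k-min = suc k , pk , λ where
  zero    p0 → contradiction p0 ¬p0
  (suc m) pm → s≤s (k-min m pm)

isProperColouring? : ∀ {n k} (G : Graph n) (c : Fin n → Fin k) →
                     Dec (IsProperColouring G c)
isProperColouring? G c =
  all? λ u → all? λ v → adj? G u v →-dec ¬? (c u ≟ c v)

colourable? : ∀ {n} (G : Graph n) → U.Decidable (Colourable G)
colourable? {n} G k = map′
  (λ (i , proper) → finToFun i , proper)
  (λ (c , proper) → funToFin c , λ u v uv eq → proper u v uv
    (trans (sym (finToFun-funToFin c u)) (trans eq (finToFun-funToFin c v))))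
  (any? λ i → isProperColouring? G (finToFun {k} {n} i))

chromaticNumber : ∀ {n} (G : Graph n) → ∃ (IsLeast (Colourable G))
chromaticNumber {n} G =
  least (colourable? G) n (id , λ u v uv u≡v → loopless G u≡v uv)

χ : ∀ {n} → Graph n → ℕ
χ G = proj₁ (chromaticNumber G)

-- Next i j: j is the successor of i in the cyclic order 0, 1, …, k − 1, 0.
Next : ∀ {k} → Rel (Fin k) 0ℓ
Next {k} i j = toℕ j ≡ suc (toℕ i) ⊎ (suc (toℕ i) ≡ k × toℕ j ≡ 0)

record Cycle {n : ℕ} (G : Graph n) : Set where
  field
    length    : ℕ
    3≤length  : 3 ≤ length
    vertex    : Fin length → Fin n
    injective : Injective _≡_ _≡_ vertex
    adjacent  : ∀ i j → Next i j → Adj G (vertex i) (vertex j)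

module _ {n : ℕ} {G : Graph n} (C : Cycle G) where
  open Cycle C

  OnCycle : Fin n → Set
  OnCycle x = ∃[ i ] vertex i ≡ x

  Consecutive : Rel (Fin n) 0ℓ
  Consecutive x y =
    ∃[ i ] ∃[ j ] (Next i j ⊎ Next j i) × vertex i ≡ x × vertex j ≡ y

  IsChord : Rel (Fin n) 0ℓ
  IsChord x y = Adj G x y × OnCycle x × OnCycle y × ¬ Consecutive x y

  -- An edge {x , y} is represented by the pair (x , y) with x < y, so that
  -- distinct pairs are distinct edges.
  HasAtLeastChords : ℕ → Set
  HasAtLeastChords k =
    ∃[ e ] Injective {A = Fin k} {B = Fin n × Fin n} _≡_ _≡_ e
         × (∀ i → proj₁ (e i) < proj₂ (e i) × IsChord (proj₁ (e i)) (proj₂ (e i)))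

{-# OPTIONS --safe #-}
-- In a minimal counterexample all degrees are at least 3. Take a longest path h … z such that,
-- among all longest paths, the neighbour w of h furthest along the path is as far as possible, and
-- let C be the cycle h … w h. Rotating the part h … w of the path (Pósa) yields further vertices
-- all of whose neighbours lie on C, and each of them is incident with a chord. If C has at most three
-- chords, this determines the structure of C up to a few cases and the lengths of some segments:
-- there is a K₄, or a vertex whose neighbourhood is contained in that of another vertex, or every
-- colouring of the rest of the graph extends to the vertices with all neighbours on C. The case
-- analysis is done by a proof-producing search over symbolic descriptions of C.

module Submission where

open import Defs
open import Data.Bool.Base using (Bool; true; false; if_then_else_; not)
open import Data.Bool.ListAction using (any)
open import Data.Empty using (⊥-elim)
open import Data.Fin.Base as Fin using (Fin; zero; suc; toℕ; _<_)
import Data.Fin.Properties as Fin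
open import Data.List.Base
  using (List; []; _∷_; _++_; [_]; _∷ʳ_; map; length; lookup; filter; filterᵇ; concatMap;
         catMaybes; allFin; head)
open import Data.List.Membership.Propositional using (_∈_; _∉_; find; lose)
open import Data.List.Membership.Propositional.Properties
  using (∈-map⁺; ∈-map⁻; ∈-++⁺ˡ; ∈-++⁺ʳ; ∈-++⁻; ∈-∃++; ∈-filter⁺; ∈-allFin; ∈-lookup)
import Data.List.Properties as List
open import Data.List.Relation.Binary.Permutation.Propositional
  using (_↭_; ↭-refl; ↭-sym; ↭-trans; ↭⇒↭ₛ)
import Data.List.Relation.Binary.Permutation.Propositional.Properties as Perm
import Data.List.Relation.Binary.Permutation.Setoid.Properties as PermSetoid
open import Data.List.Relation.Unary.All as All using (All; []; _∷_)
import Data.List.Relation.Unary.All.Properties as All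
open import Data.List.Relation.Unary.AllPairs as AllPairs using (AllPairs; []; _∷_)
import Data.List.Relation.Unary.AllPairs.Properties as AllPairs
open import Data.List.Relation.Unary.Any as Any using (Any; here; there)
import Data.List.Relation.Unary.Any.Properties as Any
open import Data.List.Relation.Unary.Linked as Linked using (Linked; []; [-]; _∷_)
open import Data.List.Relation.Unary.Unique.Propositional using (Unique)
open import Data.Maybe.Base as Maybe using (Maybe; just; nothing; is-just; _>>=_; _<∣>_)
open import Data.Nat.Base using (ℕ; zero; suc; _+_; _≤_; _≥_; z≤n; s≤s)
import Data.Nat.Base as ℕ
import Data.Nat.Properties as ℕ
open import Data.Product.Base using (Σ; Σ-syntax; ∃; ∃-syntax; ∃₂; _×_; _,_; proj₁; proj₂; swap)
import Data.Product.Base as Product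
import Data.Product.Properties as Product
open import Data.Sum.Base as Sum using (_⊎_; inj₁; inj₂; [_,_]′)
open import Function.Base using (_∘_; _on_; case_of_)
open import Function.Definitions using (Injective)
open import Level using (Level)
open import Relation.Binary.Core using (Rel)
open import Relation.Binary.Definitions using (Symmetric; tri<; tri≈; tri>)
open import Relation.Binary.PropositionalEquality
  using (_≡_; _≢_; refl; sym; trans; cong; subst; setoid)
open import Relation.Nullary.Decidable
  using (Dec; yes; no; does; ¬?; _×-dec_; _⊎-dec_; _→-dec_; dec⇒maybe; decidable-stable)
open import Relation.Nullary.Negation using (¬_; contradiction)

-- Lookup in linked and duplicate-free lists.

private
  variable
    a ℓ : Level
    A : Set a

lookup-injective : {xs : List A} → Unique xs → Injective _≡_ _≡_ (lookup xs)
lookup-injective (_ ∷ _)   {zero}  {zero}  _  = refl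
lookup-injective (x∉ ∷ _)  {zero}  {suc j} eq = contradiction eq (All.lookup x∉ (∈-lookup j))
lookup-injective (x∉ ∷ _)  {suc i} {zero}  eq = contradiction (sym eq) (All.lookup x∉ (∈-lookup i))
lookup-injective (_ ∷ uxs) {suc i} {suc j} eq = cong suc (lookup-injective uxs eq)

AllPairs-lookup : {R : Rel A ℓ} → Symmetric R → {xs : List A} → AllPairs R xs →
                  ∀ i j → i ≢ j → R (lookup xs i) (lookup xs j)
AllPairs-lookup sy (_ ∷ _)    zero    zero    i≢j = contradiction refl i≢j
AllPairs-lookup sy (x~ ∷ _)   zero    (suc j) _   = All.lookup x~ (∈-lookup j)
AllPairs-lookup sy (x~ ∷ _)   (suc i) zero    _   = sy (All.lookup x~ (∈-lookup i))
AllPairs-lookup sy (_ ∷ pxs)  (suc i) (suc j) i≢j = AllPairs-lookup sy pxs i j (i≢j ∘ cong suc)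

Linked-lookup⁺ : {R : Rel A ℓ} {xs : List A} → Linked R xs →
                 ∀ i j → toℕ j ≡ suc (toℕ i) → R (lookup xs i) (lookup xs j)
Linked-lookup⁺ (xy ∷ _)  zero    (suc zero) _  = xy
Linked-lookup⁺ (_ ∷ lxs) (suc i) (suc j)    eq = Linked-lookup⁺ lxs i j (ℕ.suc-injective eq)

Linked-lookup⁻ : {R : Rel A ℓ} (xs : List A) →
                 (∀ i j → toℕ j ≡ suc (toℕ i) → R (lookup xs i) (lookup xs j)) → Linked R xs
Linked-lookup⁻ []           f = []
Linked-lookup⁻ (x ∷ [])     f = [-]
Linked-lookup⁻ (x ∷ y ∷ xs) f =
  f zero (suc zero) refl ∷ Linked-lookup⁻ (y ∷ xs) λ i j eq → f (suc i) (suc j) (cong suc eq)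

Linked-++⁻ˡ : {R : Rel A ℓ} (xs : List A) {ys : List A} → Linked R (xs ++ ys) → Linked R xs
Linked-++⁻ˡ []           _        = []
Linked-++⁻ˡ (x ∷ [])     _        = [-]
Linked-++⁻ˡ (x ∷ y ∷ xs) (r ∷ rs) = r ∷ Linked-++⁻ˡ (y ∷ xs) rs

AllPairs-++⁻ˡ : {R : Rel A ℓ} (xs : List A) {ys : List A} → AllPairs R (xs ++ ys) → AllPairs R xs
AllPairs-++⁻ˡ []       _          = []
AllPairs-++⁻ˡ (x ∷ xs) (r ∷ rs) = All.++⁻ˡ xs r ∷ AllPairs-++⁻ˡ xs rs

Unique-resp-↭ : {xs ys : List A} → xs ↭ ys → Unique xs → Unique ys
Unique-resp-↭ p = PermSetoid.Unique-resp-↭ (setoid _) (↭⇒↭ₛ p)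

lastIndex : (xs : List A) (w : A) → Σ[ i ∈ Fin (length (xs ∷ʳ w)) ] suc (toℕ i) ≡ length (xs ∷ʳ w)
lastIndex []       w = zero , refl
lastIndex (x ∷ xs) w = Product.map suc (cong suc) (lastIndex xs w)

lookup-last : (xs : List A) (w : A) (i : Fin (length (xs ∷ʳ w))) →
              suc (toℕ i) ≡ length (xs ∷ʳ w) → lookup (xs ∷ʳ w) i ≡ w
lookup-last []       w zero    _  = refl
lookup-last (x ∷ []) w zero ()
lookup-last (x ∷ _ ∷ xs) w zero ()
lookup-last (x ∷ xs) w (suc i) eq = lookup-last xs w i (ℕ.suc-injective eq)

Unique-length : ∀ {n} {xs : List (Fin n)} → Unique xs → length xs ≤ n
Unique-length uxs = Fin.injective⇒≤ (lookup-injective uxs)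

All-just : {P : A → Set} → (∀ x → Maybe (P x)) → ∀ xs → Maybe (All P xs)
All-just f []       = just []
All-just f (x ∷ xs) = f x >>= λ px → All-just f xs >>= λ pxs → just (px ∷ pxs)

from-is-just : {P : Set} (m : Maybe P) → is-just m ≡ true → P
from-is-just (just p) _ = p

-- Succession along a cycle, and distinct chords.

module _ {n : ℕ} {G : Graph n} (C : Cycle G) where
  open Cycle C renaming (length to k)

  Follows : Rel (Fin n) _
  Follows x y = ∃[ i ] ∃[ j ] Next i j × vertex i ≡ x × vertex j ≡ y

  Next-functional : ∀ {i j j′ : Fin k} → Next i j → Next i j′ → j ≡ j′
  Next-functional (inj₁ p)       (inj₁ q)       = Fin.toℕ-injective (trans p (sym q))
  Next-functional {j = j} (inj₁ p) (inj₂ (q , _)) =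
    contradiction (trans p q) (ℕ.<⇒≢ (Fin.toℕ<n j))
  Next-functional {j′ = j} (inj₂ (q , _)) (inj₁ p) =
    contradiction (trans p q) (ℕ.<⇒≢ (Fin.toℕ<n j))
  Next-functional (inj₂ (_ , p)) (inj₂ (_ , q)) = Fin.toℕ-injective (trans p (sym q))

  Next-injective : ∀ {i i′ j : Fin k} → Next i j → Next i′ j → i ≡ i′
  Next-injective (inj₁ p) (inj₁ q) = Fin.toℕ-injective (ℕ.suc-injective (trans (sym p) q))
  Next-injective (inj₁ p) (inj₂ (_ , q)) = case trans (sym p) q of λ ()
  Next-injective (inj₂ (_ , q)) (inj₁ p) = case trans (sym p) q of λ ()
  Next-injective (inj₂ (p , _)) (inj₂ (q , _)) =
    Fin.toℕ-injective (ℕ.suc-injective (trans p (sym q)))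

  follows-adj : ∀ {x y} → Follows x y → Adj G x y
  follows-adj (i , j , nx , refl , refl) = adjacent i j nx

  -- `Next` is functional and injective, so `p` and `q` are the only vertices consecutive with `x`.
  nonconsecutive : ∀ {p x q v} → Follows p x → Follows x q → v ≢ p → v ≢ q → ¬ Consecutive C x v
  nonconsecutive _ (i , j , nx , ei , refl) _ v≢q (i′ , j′ , inj₁ nx′ , ei′ , refl) =
    v≢q (cong vertex (Next-functional
      (subst (λ i → Next i j′) (injective (trans ei′ (sym ei))) nx′) nx))
  nonconsecutive (i , j , nx , refl , ej) _ v≢p _ (j′ , i′ , inj₂ nx′ , ej′ , refl) =
    v≢p (cong vertex (Next-injective
      (subst (Next i′) (injective (trans ej′ (sym ej))) nx′) nx))

  chord-sym : ∀ {x y} → IsChord C x y → IsChord C y x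
  chord-sym (xy , ox , oy , ¬c) = symmetric G xy , oy , ox ,
    λ (i , j , nx , ei , ej) → ¬c (j , i , Sum.swap nx , ej , ei)

  -- Chords turn up in either orientation, so they are compared as unordered pairs; `orient` sorts
  -- them at the end.
  Different : Rel (Fin n × Fin n) _
  Different e f = e ≢ f × e ≢ swap f

  different-sym : Symmetric Different
  different-sym (p , q) = p ∘ sym , λ eq → q (sym (cong swap eq))

  orient : Fin n × Fin n → Fin n × Fin n
  orient (x , y) with Fin.<-cmp x y
  ... | tri< _ _ _ = x , y
  ... | tri≈ _ _ _ = x , y
  ... | tri> _ _ _ = y , x

  orient-≡ : ∀ e → orient e ≡ e ⊎ orient e ≡ swap e
  orient-≡ (x , y) with Fin.<-cmp x y
  ... | tri< _ _ _ = inj₁ refl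
  ... | tri≈ _ _ _ = inj₁ refl
  ... | tri> _ _ _ = inj₂ refl

  orient-chord : ∀ {x y} → IsChord C x y → let (u , v) = orient (x , y) in u < v × IsChord C u v
  orient-chord {x} {y} ch with Fin.<-cmp x y
  ... | tri< x<y _ _ = x<y , ch
  ... | tri≈ _ x≡y _ = contradiction (proj₁ ch) (loopless G x≡y)
  ... | tri> _ _ y<x = y<x , chord-sym ch

  orient-different : ∀ {e f} → Different e f → orient e ≢ orient f
  orient-different {e} {f} (e≢f , e≢f′) eq with orient-≡ e | orient-≡ f
  ... | inj₁ p | inj₁ q = e≢f (trans (sym p) (trans eq q))
  ... | inj₁ p | inj₂ q = e≢f′ (trans (sym p) (trans eq q))
  ... | inj₂ p | inj₁ q = e≢f′ (cong swap (trans (sym p) (trans eq q)))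
  ... | inj₂ p | inj₂ q = e≢f (cong swap (trans (sym p) (trans eq q)))

  hasChords : (es : List (Fin n × Fin n)) → All (λ (x , y) → IsChord C x y) es →
              AllPairs Different es → HasAtLeastChords C (length es)
  hasChords es chs diff = orient ∘ lookup es , inj , λ i → orient-chord (All.lookup chs (∈-lookup i))
    where
    inj : Injective _≡_ _≡_ (orient ∘ lookup es)
    inj {i} {j} eq with i Fin.≟ j
    ... | yes i≡j = i≡j
    ... | no  i≢j = contradiction eq (orient-different (AllPairs-lookup different-sym diff i j i≢j))

-- Closing a path to a cycle.

module _ {n : ℕ} (G : Graph n) where

  module ClosedPath {h w : Fin n} {q : List (Fin n)} (unique : Unique (h ∷ q ∷ʳ w))
    (linked : Linked (Adj G) (h ∷ q ∷ʳ w)) (h~w : Adj G h w) (1≤q : 1 ≤ length q) where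

    l : List (Fin n)
    l = h ∷ q ∷ʳ w

    cycle : Cycle G
    cycle = record
      { length    = length l
      ; 3≤length  = s≤s (subst (2 ≤_) (sym (trans (List.length-++ q) (ℕ.+-comm (length q) 1))) (s≤s 1≤q))
      ; vertex    = lookup l
      ; injective = lookup-injective unique
      ; adjacent  = adjacent
      }
      where
      adjacent : ∀ i j → Next i j → Adj G (lookup l i) (lookup l j)
      adjacent i j (inj₁ eq) = Linked-lookup⁺ linked i j eq
      adjacent i zero (inj₂ (eq , _)) =
        subst (λ x → Adj G x h) (sym (lookup-last (h ∷ q) w i eq)) (symmetric G h~w)

    onCycle : ∀ {v} → v ∈ l → OnCycle cycle v
    onCycle v∈l = Any.index v∈l , sym (Any.lookup-index v∈l)

    -- With `w` repeated in front, the closing edge from `w` to `h` is one of the successions of the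
    -- list.
    follows : Linked (Follows cycle) (w ∷ l)
    follows = (i , zero , inj₂ (eq , refl) , lookup-last (h ∷ q) w i eq , refl)
            ∷ Linked-lookup⁻ l λ i j eq → i , j , inj₁ eq , refl , refl
      where
      i  = proj₁ (lastIndex (h ∷ q) w)
      eq = proj₂ (lastIndex (h ∷ q) w)

-- Words with gaps and the vertex lists that match them.

-- Words abbreviate vertex lists: a name stands for a single vertex, and nothing for a gap, that is,
-- an arbitrary, possibly empty, sequence of vertices.
Word : Set
Word = List (Maybe ℕ)

↑ : Word → Word
↑ = map (Maybe.map suc)

↑² : List (ℕ × ℕ) → List (ℕ × ℕ)
↑² = map (Product.map suc suc)

names : Word → List ℕ
names = catMaybes

successions : Word → List (ℕ × ℕ)
successions []                    = []
successions (nothing ∷ t)         = successions t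
successions (just a ∷ [])         = []
successions (just a ∷ nothing ∷ t) = successions t
successions (just a ∷ just b ∷ t) = (a , b) ∷ successions (just b ∷ t)

incident : ℕ → List (ℕ × ℕ) → List ℕ
incident e []             = []
incident e ((a , b) ∷ ps) with a ℕ.≟ e | b ℕ.≟ e
... | yes _ | _     = b ∷ incident e ps
... | no _  | yes _ = a ∷ incident e ps
... | no _  | no _  = incident e ps

∈-incident⁻ : ∀ {e y} ps → y ∈ incident e ps → (e , y) ∈ ps ⊎ (y , e) ∈ ps
∈-incident⁻ {e} ((a , b) ∷ ps) y∈ with a ℕ.≟ e | b ℕ.≟ e
∈-incident⁻ ((a , b) ∷ ps) (here refl) | yes refl | _        = inj₁ (here refl)
∈-incident⁻ ((a , b) ∷ ps) (here refl) | no _     | yes refl = inj₂ (here refl)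
∈-incident⁻ ((a , b) ∷ ps) (there y∈)  | yes refl | _        = Sum.map there there (∈-incident⁻ ps y∈)
∈-incident⁻ ((a , b) ∷ ps) (there y∈)  | no _     | yes refl = Sum.map there there (∈-incident⁻ ps y∈)
∈-incident⁻ ((a , b) ∷ ps) y∈          | no _     | no _     = Sum.map there there (∈-incident⁻ ps y∈)

∈-incident⁺ˡ : ∀ {e y ps} → (e , y) ∈ ps → y ∈ incident e ps
∈-incident⁺ˡ {e} {y} (here refl) with e ℕ.≟ e | y ℕ.≟ e
... | yes _  | _ = here refl
... | no e≢e | _ = contradiction refl e≢e
∈-incident⁺ˡ {e} {y} {(a , b) ∷ ps} (there p∈) with a ℕ.≟ e | b ℕ.≟ e
... | yes _ | _     = there (∈-incident⁺ˡ p∈)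
... | no _  | yes _ = there (∈-incident⁺ˡ p∈)
... | no _  | no _  = ∈-incident⁺ˡ p∈

∈-incident⁺ʳ : ∀ {e y ps} → (y , e) ∈ ps → y ∈ incident e ps
∈-incident⁺ʳ {e} {y} (here refl) with y ℕ.≟ e | e ℕ.≟ e
... | yes refl | _      = here refl
... | no _     | yes _  = here refl
... | no _     | no e≢e = contradiction refl e≢e
∈-incident⁺ʳ {e} {y} {(a , b) ∷ ps} (there p∈) with a ℕ.≟ e | b ℕ.≟ e
... | yes _ | _     = there (∈-incident⁺ʳ p∈)
... | no _  | yes _ = there (∈-incident⁺ʳ p∈)
... | no _  | no _  = ∈-incident⁺ʳ p∈

module _ {V : Set} where

  infixr 5 _◂_

  _◂_ : V → (ℕ → V) → ℕ → V
  (u ◂ ρ) zero    = u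
  (u ◂ ρ) (suc i) = ρ i

  private variable
    ρ : ℕ → V
    s t : Word
    l m : List V
    u v : V

  data Matches (ρ : ℕ → V) : Word → List V → Set where
    []   : Matches ρ [] []
    name : ∀ {a v t l} → ρ a ≡ v → Matches ρ t l → Matches ρ (just a ∷ t) (v ∷ l)
    stop : ∀ {t l} → Matches ρ t l → Matches ρ (nothing ∷ t) l
    skip : ∀ {v t l} → Matches ρ (nothing ∷ t) l → Matches ρ (nothing ∷ t) (v ∷ l)

  Matches-↑ : Matches ρ t l → Matches (u ◂ ρ) (↑ t) l
  Matches-↑ []         = []
  Matches-↑ (name e m) = name e (Matches-↑ m)
  Matches-↑ (stop m)   = stop (Matches-↑ m)
  Matches-↑ (skip m)   = skip (Matches-↑ m)

  Matches-++⁺ : Matches ρ s l → Matches ρ t m → Matches ρ (s ++ t) (l ++ m)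
  Matches-++⁺ []         ms = ms
  Matches-++⁺ (name e m) ms = name e (Matches-++⁺ m ms)
  Matches-++⁺ (stop m)   ms = stop (Matches-++⁺ m ms)
  Matches-++⁺ (skip m)   ms = skip (Matches-++⁺ m ms)

  Matches-++⁻ : ∀ s → Matches ρ (s ++ t) l →
                ∃₂ λ l₁ l₂ → l₁ ++ l₂ ≡ l × Matches ρ s l₁ × Matches ρ t l₂
  Matches-++⁻ []            m = [] , _ , refl , [] , m
  Matches-++⁻ (just _ ∷ s)  (name e m) with _ , _ , refl , m₁ , m₂ ← Matches-++⁻ s m =
    _ , _ , refl , name e m₁ , m₂
  Matches-++⁻ (nothing ∷ s) (stop m) with _ , _ , refl , m₁ , m₂ ← Matches-++⁻ s m =
    _ , _ , refl , stop m₁ , m₂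
  Matches-++⁻ (nothing ∷ s) (skip m) with _ , _ , refl , m₁ , m₂ ← Matches-++⁻ (nothing ∷ s) m =
    _ , _ , refl , skip m₁ , m₂

  gap-first : Matches ρ (nothing ∷ t) l →
              Matches ρ t l ⊎ ∃[ u ] Matches (u ◂ ρ) (just 0 ∷ nothing ∷ ↑ t) l
  gap-first (stop m) = inj₁ m
  gap-first (skip m) = inj₂ (_ , name refl (Matches-↑ m))

  gap-last : Matches ρ (nothing ∷ t) l →
             Matches ρ t l ⊎ ∃[ u ] Matches (u ◂ ρ) (nothing ∷ just 0 ∷ ↑ t) l
  gap-last (stop m) = inj₁ m
  gap-last (skip m) with gap-last m
  ... | inj₁ m′       = inj₂ (_ , stop (name refl (Matches-↑ m′)))
  ... | inj₂ (u , m′) = inj₂ (u , skip m′)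

  Matches-names : ∀ {a} → Matches ρ t l → a ∈ names t → ρ a ∈ l
  Matches-names (name e m) (here refl) = here e
  Matches-names (name e m) (there a∈)  = there (Matches-names m a∈)
  Matches-names (stop m)   a∈          = Matches-names m a∈
  Matches-names (skip m)   a∈          = there (Matches-names m a∈)

  Matches-injective : ∀ {a b} → Matches ρ t l → Unique l → a ∈ names t → b ∈ names t → ρ a ≡ ρ b → a ≡ b
  Matches-injective (name e m) _ (here refl) (here refl) _ = refl
  Matches-injective (name refl m) (v∉ ∷ _) (here refl) (there b∈) eq =
    contradiction eq (All.lookup v∉ (Matches-names m b∈))
  Matches-injective (name refl m) (v∉ ∷ _) (there a∈) (here refl) eq =
    contradiction (sym eq) (All.lookup v∉ (Matches-names m a∈))
  Matches-injective (name e m) (_ ∷ ul) (there a∈) (there b∈) eq = Matches-injective m ul a∈ b∈ eq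
  Matches-injective (stop m) ul a∈ b∈ eq = Matches-injective m ul a∈ b∈ eq
  Matches-injective (skip m) (_ ∷ ul) a∈ b∈ eq = Matches-injective m ul a∈ b∈ eq

  Matches-successions : {R : Rel V ℓ} → Matches ρ t l → Linked R l →
                        All (λ (a , b) → R (ρ a) (ρ b)) (successions t)
  Matches-successions [] _ = []
  Matches-successions (name e []) _ = []
  Matches-successions (name refl m@(name refl _)) (r ∷ rs) = r ∷ Matches-successions m rs
  Matches-successions (name e (stop m)) rs = Matches-successions m (Linked.tail rs)
  Matches-successions (name e (skip m)) rs = Matches-successions m (Linked.tail (Linked.tail rs))
  Matches-successions (stop m) rs = Matches-successions m rs
  Matches-successions (skip m) rs = Matches-successions m (Linked.tail rs)

  -- The places of a word where a vertex can lie: at a name, or in a gap. In the second case the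
  -- word is refined so that the vertex gets the new name 0 (names are de Bruijn indices).
  data Spot : Set where
    named : ℕ → Spot
    inGap : Word → Spot

  Occupies : (ℕ → V) → V → List V → Spot → Set
  Occupies ρ v l (named a) = ρ a ≡ v
  Occupies ρ v l (inGap t) = Matches (v ◂ ρ) t l

  under : Maybe ℕ → Spot → Spot
  under x (named a) = named a
  under x (inGap t) = inGap (Maybe.map suc x ∷ t)

  spots : Word → List Spot
  spots []            = []
  spots (just a ∷ t)  = named a ∷ map (under (just a)) (spots t)
  spots (nothing ∷ t) = inGap (nothing ∷ just 0 ∷ nothing ∷ ↑ t) ∷ map (under nothing) (spots t)

  spots-complete : Matches ρ t l → v ∈ l → Any (Occupies ρ v l) (spots t)
  spots-complete (name e m) (here refl) = here e
  spots-complete (name e m) (there v∈)  = there (Any.map⁺ (Any.map step (spots-complete m v∈)))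
    where
    step : ∀ {sp} → Occupies _ _ _ sp → Occupies _ _ _ (under (just _) sp)
    step {named _} o = o
    step {inGap _} o = name e o
  spots-complete (stop m) v∈ = there (Any.map⁺ (Any.map step (spots-complete m v∈)))
    where
    step : ∀ {sp} → Occupies _ _ _ sp → Occupies _ _ _ (under nothing sp)
    step {named _} o = o
    step {inGap _} o = stop o
  spots-complete (skip m) (here refl) = here (stop (name refl (Matches-↑ m)))
  spots-complete (skip m) (there v∈) with spots-complete m v∈
  -- Here `v` lies further on in the same gap, and the part of the gap before `v` absorbs the
  -- skipped vertex.
  ... | here o  = here (skip o)
  ... | there o = there (Any.map⁺ (Any.map step (Any.map⁻ o)))
    where
    step : ∀ {sp} → Occupies _ _ _ (under nothing sp) → Occupies _ _ _ (under nothing sp)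
    step {named _} o = o
    step {inGap _} o = skip o

-- Symbolic descriptions of the cycle.

-- What is known about the cycle C: path lists its vertices up to and including the vertex end,
-- chords are some of its chords, and a closed vertex e comes with a list of all its neighbours.
record State : Set where
  constructor ⟨_,_,_,_⟩
  field
    end     : ℕ
    path    : Word
    chords  : List (ℕ × ℕ)
    closed  : List (ℕ × List ℕ)

open State

-- The end is repeated in front so that the closing edge of the cycle is among the `successions`.
word : State → Word
word s = just (end s) ∷ path s

edges : State → List (ℕ × ℕ)
edges s = successions (word s) ++ chords s

nbrs : State → ℕ → List ℕ
nbrs s e = incident e (edges s)

-- A marked gap, together with the end of it at which a vertex is to be named if the gap is
-- nonempty.
data GapSplit : Word → Set where
  first last : ∀ A B → GapSplit (A ++ nothing ∷ B)

infix 4 _∈?_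

_∈?_ : (a : ℕ) (as : List ℕ) → Dec (a ∈ as)
a ∈? as = Any.any? (a ℕ.≟_) as

-- The end facing a name in `W` is chosen: if the gap is nonempty, the cycle neighbour of that name
-- on this side then receives a name.
gapAt : List ℕ → ∀ x t → Maybe (GapSplit (x ∷ t))
gapAt W (just a) (nothing ∷ B) = if does (a ∈? W) then just (first [ just a ] B) else nothing
gapAt W nothing (just b ∷ B)   = if does (b ∈? W) then just (last [] (just b ∷ B)) else nothing
gapAt W _       _              = nothing

gapBeside : List ℕ → ∀ t → Maybe (GapSplit t)
gapBeside W []      = nothing
gapBeside W (x ∷ t) = gapAt W x t <∣> Maybe.map cons (gapBeside W t)
  where
  cons : GapSplit t → GapSplit (x ∷ t)
  cons (first A B) = first (x ∷ A) B
  cons (last A B)  = last (x ∷ A) B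

-- Three-colourings and the search for extensions.

Colour : Set
Colour = Fin 3

ColouringOn : ∀ {n} → Graph n → List (Fin n) → Set
ColouringOn {n} G U = Σ[ c ∈ (Fin n → Colour) ] (∀ {u v} → u ∈ U → v ∈ U → Adj G u v → c u ≢ c v)

clique : ∀ {n} (G : Graph n) (vs : List (Fin n)) → AllPairs (Adj G) vs → ContainsSubgraph G (K (length vs))
clique G vs pvs = lookup vs , inj , adjacent
  where
  adjacent : ∀ i j → i ≢ j → Adj G (lookup vs i) (lookup vs j)
  adjacent = AllPairs-lookup (symmetric G) pvs
  inj : Injective _≡_ _≡_ (lookup vs)
  inj {i} {j} eq with i Fin.≟ j
  ... | yes i≡j = i≡j
  ... | no  i≢j = contradiction (adjacent i j i≢j) (loopless G eq)

firstJust : ∀ {P : Set} (xs : List A) → (∀ x → x ∈ xs → Maybe P) → Maybe P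
firstJust []       f = nothing
firstJust (x ∷ xs) f = f x (here refl) <∣> firstJust xs λ y y∈ → f y (there y∈)

colours : List Colour
colours = zero ∷ suc zero ∷ suc (suc zero) ∷ []

Assignment : Set
Assignment = List (ℕ × Colour)

colourOf : Assignment → ℕ → Maybe Colour
colourOf []            x = nothing
colourOf ((y , k) ∷ α) x = if does (y ℕ.≟ x) then just k else colourOf α x

clashes : Assignment → Colour → ℕ → Bool
clashes α k x with colourOf α x
... | nothing = false
... | just k′ = does (k Fin.≟ k′)

-- Backtracking: the rest of the list is coloured inside the choice of `k`, and a neighbour without
-- a colour never clashes. The outcome is verified afterwards by `check`.
extend : List (ℕ × List ℕ) → Assignment → Maybe Assignment
extend []             α = just α
extend ((t , N) ∷ cl) α = firstJust colours λ k _ →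
  if any (clashes α k) N then nothing else extend cl ((t , k) ∷ α)

Extends : List (ℕ × List ℕ) → (ℕ → Colour) → Set
Extends cl f = Σ[ h ∈ (ℕ → Colour) ] (∀ {x} → x ∉ map proj₁ cl → h x ≡ f x)
             × All (λ (t , N) → All (λ y → h t ≢ h y) N) cl

AgreesWith : Assignment → (ℕ → Colour) → Set
AgreesWith α f = All (λ (x , k) → f x ≡ k) α

-- The test accepts a neighbour only if it is recoloured itself or has its colour prescribed by `α`;
-- at any other vertex nothing is known about `f`.
extension : ∀ cl α → Maybe (∀ f → AgreesWith α f → Extends cl f)
-- The default `zero` is harmless: a neighbour not coloured by `β` is neither in `ts` nor coloured
-- by `α`, so the test rejects it.
extension cl α = extend cl α >>= λ β → check (λ x → Maybe.fromMaybe zero (colourOf β x))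
  where
  ts = map proj₁ cl
  pair? = Product.≡-dec ℕ._≟_ Fin._≟_
  check : (ℕ → Colour) → Maybe (∀ f → AgreesWith α f → Extends cl f)
  check g = Maybe.map conclude (dec⇒maybe (All.all? (λ (t , N) → All.all? (λ y →
      ¬? (g t Fin.≟ g y) ×-dec (y ∈? ts ⊎-dec Any.any? (pair? (y , g y)) α)) N) cl))
    where
    conclude : All (λ (t , N) → All (λ y → g t ≢ g y × (y ∈ ts ⊎ (y , g y) ∈ α)) N) cl →
               ∀ f → AgreesWith α f → Extends cl f
    conclude ok f ag = h , off , All.tabulate λ {(t , N)} tN∈ →
        All.map (λ (g≢ , y∈) eq → g≢ (trans (sym (on (∈-map⁺ proj₁ tN∈))) (trans eq (ag-h y∈))))
                (All.lookup ok tN∈)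
      where
      h : ℕ → Colour
      h x = if does (x ∈? ts) then g x else f x
      off : ∀ {x} → x ∉ ts → h x ≡ f x
      off {x} x∉ with x ∈? ts
      ... | yes x∈ = contradiction x∈ x∉
      ... | no  _  = refl
      on : ∀ {x} → x ∈ ts → h x ≡ g x
      on {x} x∈ with x ∈? ts
      ... | yes _  = refl
      ... | no  x∉ = contradiction x∈ x∉
      ag-h : ∀ {y} → y ∈ ts ⊎ (y , g y) ∈ α → h y ≡ g y
      ag-h (inj₁ y∈) = on y∈
      ag-h {y} (inj₂ yα) with y ∈? ts
      ... | yes _ = refl
      ... | no  _ = All.lookup ag yα

-- All colourings of `xs` are enumerated beforehand; the values of a given `f` then select one of
-- the branches.
extensions : ∀ cl → List ℕ → ∀ α → Maybe (∀ f → AgreesWith α f → Extends cl f)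
extensions cl []       α = extension cl α
extensions cl (x ∷ xs) α =
  extensions cl xs ((x , zero) ∷ α)             >>= λ e₀ →
  extensions cl xs ((x , suc zero) ∷ α)         >>= λ e₁ →
  extensions cl xs ((x , suc (suc zero)) ∷ α)   >>= λ e₂ →
  just (cases e₀ e₁ e₂)
  where
  cases : _ → _ → _ → ∀ f → AgreesWith α f → Extends cl f
  cases e₀ e₁ e₂ f ag with f x in eq
  ... | zero           = e₀ f (eq ∷ ag)
  ... | suc zero       = e₁ f (eq ∷ ag)
  ... | suc (suc zero) = e₂ f (eq ∷ ag)

-- Deleting vertices and recolouring.

Result : ∀ {n} → Graph n → List (Fin n) → Set
Result G U = (Σ[ C ∈ Cycle G ] HasAtLeastChords C 4) ⊎ ColouringOn G U

module _ {n : ℕ} (G : Graph n) (U T : List (Fin n)) where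

  _∈T? : ∀ v → Dec (v ∈ T)
  v ∈T? = Any.any? (v Fin.≟_) T

  ProperOutside : (Fin n → Colour) → Set
  ProperOutside c = ∀ {x y} → x ∈ U → x ∉ T → y ∈ U → y ∉ T → Adj G x y → c x ≢ c y

  Recolouring : (Fin n → Colour) → Set
  Recolouring c = Σ[ c′ ∈ (Fin n → Colour) ] (∀ {x} → x ∉ T → c′ x ≡ c x)
                × (∀ {x y} → x ∈ U → x ∈ T → y ∈ U → Adj G x y → c′ x ≢ c′ y)

  -- The induction step of every reduction: `T` meets `U`, so `U` without `T` is smaller and has a
  -- result. If that is a colouring, `f` adapts it to `T`; an edge with only its second end in `T`
  -- is treated by symmetry.
  recolour : (∀ U′ → length U′ ℕ.< length U → Result G U′) → ∀ {u} → u ∈ U → u ∈ T →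
             (∀ c → ProperOutside c → Recolouring c) → Result G U
  recolour smaller u∈U u∈T f
    with smaller (filter (¬? ∘ _∈T?) U) (List.filter-notAll (¬? ∘ _∈T?) U (lose u∈U (λ u∉ → u∉ u∈T)))
  ... | inj₁ goal = inj₁ goal
  ... | inj₂ (c , proper) = inj₂ (c′ , proper′)
    where
    outside : ProperOutside c
    outside x∈ x∉ y∈ y∉ = proper (∈-filter⁺ (¬? ∘ _∈T?) x∈ x∉) (∈-filter⁺ (¬? ∘ _∈T?) y∈ y∉)
    c′  = proj₁ (f c outside)
    off = proj₁ (proj₂ (f c outside))
    on  = proj₂ (proj₂ (f c outside))
    proper′ : ∀ {x y} → x ∈ U → y ∈ U → Adj G x y → c′ x ≢ c′ y
    proper′ {x} {y} x∈ y∈ xy with x ∈T? | y ∈T?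
    ... | yes xT | _      = on x∈ xT y∈ xy
    ... | no _   | yes yT = on y∈ yT x∈ (symmetric G xy) ∘ sym
    ... | no xT  | no yT  = λ eq → outside x∈ xT y∈ yT xy (trans (sym (off xT)) (trans eq (off yT)))

-- States and their realisations in a graph.

-- C runs through the initial part l of a path l ++ r. The field inside expresses that this path
-- cannot be prolonged and that C is as long as possible, and does so for all paths a ++ r with a a
-- rearrangement of l.
record Setting : Set₁ where
  field
    {n}     : ℕ
    G       : Graph n
    U       : List (Fin n)
    C       : Cycle G
    {w}     : Fin n
    {l r}   : List (Fin n)
    unique  : Unique l
    onCycle : ∀ {v} → v ∈ l → OnCycle C v
    follows : Linked (Follows C) (w ∷ l)
    good    : Linked (Adj G) (l ++ r)
    l⊆U     : ∀ {v} → v ∈ l → v ∈ U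
    escape  : ∀ {u} → u ∈ U → ∀ a b → ∃[ v ] v ∈ U × Adj G u v × v ≢ a × v ≢ b
    smaller : ∀ U′ → length U′ ℕ.< length U →
              Result G U′
    noK4    : ¬ ContainsSubgraph G (K 4)
    inside  : ∀ {u a v} → u ∷ a ↭ l → Linked (Adj G) (u ∷ a ++ r) → v ∈ U → Adj G u v →
              v ∈ l ⊎ Result G U

module Search (S : Setting) where
  open Setting S

  V : Set
  V = Fin n

  infix 4 _~_

  _~_ : V → V → Set
  _~_ = Adj G

  -- Then `a ++ r` is a path on the same vertices as `l ++ r`, and `inside` applies to its first
  -- vertex.
  Good : List V → Set
  Good a = a ↭ l × Linked _~_ (a ++ r)

  record Facts (ρ : ℕ → V) (X : List (ℕ × ℕ)) (cl : List (ℕ × List ℕ)) : Set where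
    field
      isChord  : All (λ (a , b) → IsChord C (ρ a) (ρ b)) X
      distinct : AllPairs (Different C on Product.map ρ ρ) X
      complete : All (λ (e , N) → ∀ {v} → v ∈ U → ρ e ~ v → Any (λ b → ρ b ≡ v) N) cl

  open Facts

  ↑ᶜ : List (ℕ × List ℕ) → List (ℕ × List ℕ)
  ↑ᶜ = map (Product.map suc (map suc))

  Facts-↑ : ∀ {ρ u X cl} → Facts ρ X cl → Facts (u ◂ ρ) (↑² X) (↑ᶜ cl)
  Facts-↑ f = record
    { isChord  = All.map⁺ (isChord f)
    ; distinct = AllPairs.map⁺ (distinct f)
    ; complete = All.map⁺ (All.map (λ c {_} v∈ uv → Any.map⁺ (c v∈ uv)) (complete f))
    }

  record Sat (ρ : ℕ → V) (s : State) : Set where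
    constructor sat
    field
      isEnd   : ρ (end s) ≡ w
      matches : Matches ρ (path s) l
      facts   : Facts ρ (chords s) (closed s)

  open Sat

  Closes : State → Set
  Closes s = ∀ {ρ} → Sat ρ s → Result G U

  edges-adj : ∀ {ρ s} → Sat ρ s → All (λ (a , b) → ρ a ~ ρ b) (edges s)
  edges-adj (sat e m f) =
    All.++⁺ (All.map (follows-adj C) (Matches-successions (name e m) follows)) (All.map proj₁ (isChord f))

  nbrs-adj : ∀ {ρ s e y} → Sat ρ s → y ∈ nbrs s e → ρ e ~ ρ y
  nbrs-adj {s = s} p y∈ with ∈-incident⁻ (edges s) y∈
  ... | inj₁ ey∈ = All.lookup (edges-adj p) ey∈
  ... | inj₂ ye∈ = symmetric G (All.lookup (edges-adj p) ye∈)

  module _ (o : ℕ) (X : List (ℕ × ℕ)) (cl : List (ℕ × List ℕ)) where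

    without : ∀ {t} → GapSplit t → State
    without (first A B) = ⟨ o , A ++ B , X , cl ⟩
    without (last A B)  = ⟨ o , A ++ B , X , cl ⟩

    exposed : ∀ {t} → GapSplit t → State
    exposed (first A B) = ⟨ suc o , ↑ A ++ just 0 ∷ nothing ∷ ↑ B , ↑² X , ↑ᶜ cl ⟩
    exposed (last A B)  = ⟨ suc o , ↑ A ++ nothing ∷ just 0 ∷ ↑ B , ↑² X , ↑ᶜ cl ⟩

    closes-split : ∀ {t} (g : GapSplit t) →
                   Closes (without g) → Closes (exposed g) → Closes ⟨ o , t , X , cl ⟩
    closes-split (first A B) c₁ c₂ (sat e m f)
      with _ , _ , eq , mA , mB ← Matches-++⁻ A m with gap-first mB
    ... | inj₁ mB′       = c₁ (sat e (subst (Matches _ _) eq (Matches-++⁺ mA mB′)) f)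
    ... | inj₂ (_ , mB′) =
      c₂ (sat e (subst (Matches _ _) eq (Matches-++⁺ (Matches-↑ mA) mB′)) (Facts-↑ f))
    closes-split (last A B) c₁ c₂ (sat e m f)
      with _ , _ , eq , mA , mB ← Matches-++⁻ A m with gap-last mB
    ... | inj₁ mB′       = c₁ (sat e (subst (Matches _ _) eq (Matches-++⁺ mA mB′)) f)
    ... | inj₂ (_ , mB′) =
      c₂ (sat e (subst (Matches _ _) eq (Matches-++⁺ (Matches-↑ mA) mB′)) (Facts-↑ f))

  -- Pósa rotations.

  -- A path from h is cut into a front part, stored in reverse as z ∷ xs, and a rest zs.
  -- Reattaching the front by an edge at h instead of z is a Pósa rotation.
  record Walk (ρ : ℕ → V) (h : ℕ) (acc rest : Word) : Set where
    constructor walk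
    field
      {z}    : V
      {xs zs} : List V
      front  : Matches ρ acc (z ∷ xs)
      back   : Matches ρ rest zs
      attach : ∀ {y ys} → ρ h ~ y → Linked _~_ (y ∷ ys) → Linked _~_ ((z ∷ xs) ++ y ∷ ys)
      linked : Linked _~_ ((z ∷ zs) ++ r)
      perm   : (z ∷ xs) ++ zs ↭ l

  Reaches : State → Word → Set
  Reaches s t = ∀ {ρ} → Sat ρ s → ∃[ a ] Matches ρ t a × Good a

  Head : State → ℕ → Set
  Head s e = ∀ {ρ} → Sat ρ s → ∃[ a ] Good (ρ e ∷ a)

  Walks : State → ℕ → Word → Word → Set
  Walks s h acc rest = ∀ {ρ} → Sat ρ s → Walk ρ h acc rest

  module _ {ρ : ℕ → V} {h : ℕ} where

    advance-perm : ∀ {z v a b} → (z ∷ a) ++ v ∷ b ↭ l → (v ∷ z ∷ a) ++ b ↭ l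
    advance-perm {z} {v} {a} {b} p = ↭-trans (↭-sym (Perm.shift v (z ∷ a) b)) p

    advance-name : ∀ {y acc t} → Walk ρ h acc (just y ∷ t) → Walk ρ h (just y ∷ acc) t
    advance-name (walk f (name e m) att (zv ∷ lk) p) =
      walk (name e f) m (λ hy ys → symmetric G zv ∷ att hy ys) lk (advance-perm p)

    advance-gap′ : ∀ {acc t z a b} → Matches ρ (nothing ∷ acc) (z ∷ a) → Matches ρ (nothing ∷ t) b →
                   (∀ {y ys} → ρ h ~ y → Linked _~_ (y ∷ ys) → Linked _~_ ((z ∷ a) ++ y ∷ ys)) →
                   Linked _~_ ((z ∷ b) ++ r) → (z ∷ a) ++ b ↭ l → Walk ρ h (nothing ∷ acc) t
    advance-gap′ f (stop m) att lk p = walk f m att lk p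
    advance-gap′ f (skip m) att (zv ∷ lk) p =
      advance-gap′ (skip f) m (λ hy ys → symmetric G zv ∷ att hy ys) lk (advance-perm p)

    advance-gap : ∀ {acc t} → Walk ρ h acc (nothing ∷ t) → Walk ρ h (nothing ∷ acc) t
    advance-gap (walk f m att lk p) = advance-gap′ (stop f) m att lk p

    -- The reversed front runs from `z` back to `h`, and the edge from `h` to `y` joins it to the
    -- rest. The new head is `z`, the predecessor of `y`.
    rotate : ∀ {y acc t} → ρ h ~ ρ y → Walk ρ h acc (just y ∷ t) →
             ∃[ a ] Matches ρ (acc ++ just y ∷ t) a × Good a
    rotate hy (walk {z} {a} {v ∷ b} f m@(name refl _) att (_ ∷ lk) p) =
      _ , Matches-++⁺ f m , p , subst (Linked _~_) (sym (List.++-assoc (z ∷ a) (v ∷ b) r)) (att hy lk)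

  startWalk : ∀ {s e t} → Reaches s (just e ∷ t) → Walks s e [ just e ] t
  startWalk rs p with _ , name refl m , perm , lk ← rs p =
    walk (name refl []) m (λ hy ys → hy ∷ ys) lk perm

  reachedHead : ∀ {s e t} → Reaches s (just e ∷ t) → Head s e
  reachedHead rs p with _ , name refl m , g ← rs p = _ , g

  module _ {s : State} where

    rotations : ∀ h N → (∀ {y} → y ∈ N → y ∈ nbrs s h) → ∀ acc t → Walks s h acc t → List (∃ (Reaches s))
    rotations h N N⊆ acc []            ws = []
    rotations h N N⊆ acc (nothing ∷ t) ws = rotations h N N⊆ (nothing ∷ acc) t (advance-gap ∘ ws)
    rotations h N N⊆ acc (just y ∷ t)  ws with y ∈? N
    ... | yes y∈ = (acc ++ just y ∷ t , λ p → rotate (nbrs-adj p (N⊆ y∈)) (ws p))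
                 ∷ rotations h N N⊆ (just y ∷ acc) t (advance-name ∘ ws)
    ... | no  _  = rotations h N N⊆ (just y ∷ acc) t (advance-name ∘ ws)

    -- The walk starts beyond the letter after `e`: reattaching at the successor of `e` would return
    -- the same path.
    properRotations : ∀ e N → (∀ {y} → y ∈ N → y ∈ nbrs s e) → ∀ t → Reaches s (just e ∷ t) →
                      List (∃ (Reaches s))
    properRotations e N N⊆ []            rs = []
    properRotations e N N⊆ (just x ∷ t)  rs =
      rotations e N N⊆ (just x ∷ [ just e ]) t (advance-name ∘ startWalk rs)
    properRotations e N N⊆ (nothing ∷ t) rs =
      rotations e N N⊆ (nothing ∷ [ just e ]) t (advance-gap ∘ startWalk rs)

    -- Heads of the paths obtained by at most `k` rotations. A path that begins with a gap has no
    -- named head and is abandoned.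
    heads : ∀ E → E ≡ edges s → ℕ → ∀ t → Reaches s t → List (∃ (Head s))
    heads E eq k []            rs = []
    heads E eq k (nothing ∷ t) rs = []
    heads E eq zero    (just e ∷ t) rs = [ e , reachedHead rs ]
    heads E eq (suc k) (just e ∷ t) rs = (e , reachedHead rs) ∷
      concatMap (λ (t′ , rs′) → heads E eq k t′ rs′)
        (properRotations e (incident e E) (λ {y} → subst (λ E → y ∈ incident e E) eq) t rs)

  -- Further neighbours of a head yield chords.

  Fresh : (ℕ → V) → State → ℕ → V → Set
  Fresh ρ s e v = ρ e ~ v × ¬ Any (λ b → ρ b ≡ v) (nbrs s e)

  -- Once both cycle neighbours of `e` are named, they are known neighbours, so every fresh
  -- neighbour on `l` is joined to `e` by a chord.
  record Placed (s : State) (e : ℕ) : Set where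
    field
      {pred succ} : ℕ
      pred∈   : (pred , e) ∈ edges s
      succ∈   : (e , succ) ∈ edges s
      follow₁ : ∀ {ρ} → Sat ρ s → Follows C (ρ pred) (ρ e)
      follow₂ : ∀ {ρ} → Sat ρ s → Follows C (ρ e) (ρ succ)
      onPath  : e ∈ names (path s)
      onPath² : All (λ (a , b) → a ∈ names (path s) × b ∈ names (path s)) (chords s)

  place : ∀ s e → Maybe (Placed s e)
  place s e =
    dec⇒maybe (Any.any? (λ p → proj₂ p ℕ.≟ e) (successions (word s))) >>= λ p →
    dec⇒maybe (Any.any? (λ p → proj₁ p ℕ.≟ e) (successions (word s))) >>= λ q →
    dec⇒maybe (e ∈? names (path s)) >>= λ e∈ →
    dec⇒maybe (All.all? (λ (a , b) → a ∈? names (path s) ×-dec b ∈? names (path s)) (chords s)) >>= λ X⊆ →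
    just (placed (find p) (find q) e∈ X⊆)
    where
    succession : ∀ {ρ x y} → (x , y) ∈ successions (word s) → Sat ρ s → Follows C (ρ x) (ρ y)
    succession xy∈ (sat o m _) = All.lookup (Matches-successions (name o m) follows) xy∈
    placed : (∃[ p ] p ∈ successions (word s) × proj₂ p ≡ e) →
             (∃[ p ] p ∈ successions (word s) × proj₁ p ≡ e) → _ → _ → Placed s e
    placed (_ , p∈ , refl) (_ , q∈ , refl) e∈ X⊆ = record
      { pred∈ = ∈-++⁺ˡ p∈ ; succ∈ = ∈-++⁺ˡ q∈
      ; follow₁ = succession p∈ ; follow₂ = succession q∈ ; onPath = e∈ ; onPath² = X⊆ }

  module _ {ρ : ℕ → V} {s : State} {e : ℕ} (pl : Placed s e) (p : Sat ρ s)
           {v : V} (v∈l : v ∈ l) (fresh : Fresh ρ s e v) where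
    open Placed pl

    not-nbr : ∀ {b} → b ∈ nbrs s e → v ≢ ρ b
    not-nbr b∈ refl = proj₂ fresh (Any.map (λ where refl → refl) b∈)

    fresh-chord : IsChord C (ρ e) v
    fresh-chord = proj₁ fresh , onCycle (Matches-names (matches p) onPath) , onCycle v∈l ,
      nonconsecutive C (follow₁ p) (follow₂ p)
        (not-nbr (∈-incident⁺ʳ {ps = edges s} pred∈)) (not-nbr (∈-incident⁺ˡ {ps = edges s} succ∈))

    same-name : ∀ {a} → a ∈ names (path s) → ρ e ≡ ρ a → e ≡ a
    same-name = Matches-injective (matches p) unique onPath

    -- Names on the path are injective. A recorded chord equal to this one would therefore have `e`
    -- itself as an end, and `v` would be a known neighbour of `e`.
    fresh-different : All (Different C (ρ e , v) ∘ Product.map ρ ρ) (chords s)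
    fresh-different = All.tabulate λ {(a , b)} ab∈ →
      let a∈ , b∈ = All.lookup onPath² ab∈
          ab∈E    = ∈-++⁺ʳ (successions (word s)) ab∈
      in (λ eq → not-nbr (∈-incident⁺ˡ {ps = edges s}
                   (subst (λ x → (x , b) ∈ edges s) (sym (same-name a∈ (cong proj₁ eq))) ab∈E))
                 (cong proj₂ eq))
       , (λ eq → not-nbr (∈-incident⁺ʳ {ps = edges s}
                   (subst (λ x → (a , x) ∈ edges s) (sym (same-name b∈ (cong proj₁ eq))) ab∈E))
                 (cong proj₂ eq))

  NewNeighbour : State → ℕ → Set
  NewNeighbour s e = ∀ {ρ} → Sat ρ s → ∀ {v} → v ∈ l → Fresh ρ s e v → Result G U

  fourChords : ∀ {s e c₁ c₂ c₃ X} → chords s ≡ c₁ ∷ c₂ ∷ c₃ ∷ X → Placed s e → NewNeighbour s e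
  fourChords {s} {e} {c₁} {c₂} {c₃} refl pl {ρ} p {v} v∈l fresh
    with ch₁ ∷ ch₂ ∷ ch₃ ∷ _ ← isChord (facts p)
       | (d₁₂ ∷ d₁₃ ∷ _) ∷ (d₂₃ ∷ _) ∷ _ ← distinct (facts p)
       | d₁ ∷ d₂ ∷ d₃ ∷ _ ← fresh-different pl p v∈l fresh =
    inj₁ (C , hasChords C ((ρ e , v) ∷ Product.map ρ ρ c₁ ∷ Product.map ρ ρ c₂ ∷ [ Product.map ρ ρ c₃ ])
      (fresh-chord pl p v∈l fresh ∷ ch₁ ∷ ch₂ ∷ ch₃ ∷ [])
      ((d₁ ∷ d₂ ∷ d₃ ∷ []) ∷ (d₁₂ ∷ d₁₃ ∷ []) ∷ (d₂₃ ∷ []) ∷ [] ∷ []))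

  module Expansion (rec : ∀ s → Maybe (Closes s)) where

    AtSpot : State → ℕ → Spot {V} → Set
    AtSpot s e sp = ∀ {ρ} → Sat ρ s → ∀ {v} → v ∈ l → Fresh ρ s e v → Occupies ρ v l sp → Result G U

    atSpot : ∀ {s e} → Placed s e → ∀ sp → Maybe (AtSpot s e sp)
    atSpot {s} {e} pl (named b) with b ∈? nbrs s e | b ℕ.≟ e
    ... | yes b∈ | _        = just λ _ _ (_ , new) eq → contradiction (Any.map (λ where refl → eq) b∈) new
    ... | no _   | yes refl = just λ _ _ (adj , _) eq → contradiction adj (loopless G eq)
    ... | no _   | no _     =
      rec ⟨ end s , path s , (e , b) ∷ chords s , closed s ⟩ >>= λ c →
      just λ { p v∈l fresh refl → c (sat (isEnd p) (matches p) record
        { isChord  = fresh-chord pl p v∈l fresh ∷ isChord (facts p)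
        ; distinct = fresh-different pl p v∈l fresh ∷ distinct (facts p)
        ; complete = complete (facts p) }) }
    atSpot {s} {e} pl (inGap t) =
      rec ⟨ suc (end s) , t , (suc e , 0) ∷ ↑² (chords s) , ↑ᶜ (closed s) ⟩ >>= λ c →
      just λ p v∈l fresh m → let f = Facts-↑ (facts p) in c (sat (isEnd p) m record
        { isChord  = fresh-chord pl p v∈l fresh ∷ isChord f
        ; distinct = All.map⁺ (fresh-different pl p v∈l fresh) ∷ distinct f
        ; complete = complete f })

    newNeighbour : ∀ s e → Placed s e → Maybe (NewNeighbour s e)
    newNeighbour s@(⟨ _ , _ , _ ∷ _ ∷ _ ∷ _ , _ ⟩) e pl = just (fourChords refl pl)
    newNeighbour s e pl =
      All-just (atSpot pl) (spots (path s)) >>= λ cs →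
      just λ p v∈l fresh → All.lookupWith (λ c o → c p v∈l fresh o) cs (spots-complete (matches p) v∈l)

    -- With at most two known neighbours, `e` has another one by `escape`; otherwise the state in
    -- which `e` becomes closed has to be solved.
    Complete : State → ℕ → Set
    Complete s e = length (nbrs s e) ≤ 2 ⊎ Closes ⟨ end s , path s , chords s , (e , nbrs s e) ∷ closed s ⟩

    completed : ∀ s e → Maybe (Complete s e)
    completed s e with length (nbrs s e) ℕ.≤? 2
    ... | yes ≤2 = just (inj₁ ≤2)
    ... | no  _  = Maybe.map inj₂ (rec _)

    escape′ : ∀ {u} → u ∈ U → (ρ : ℕ → V) (N : List ℕ) → length N ≤ 2 →
              ∃[ v ] v ∈ U × u ~ v × ¬ Any (λ b → ρ b ≡ v) N
    escape′ {u} u∈ ρ [] _ with v , v∈ , uv , _ ← escape u∈ u u = v , v∈ , uv , λ ()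
    escape′ u∈ ρ (b ∷ []) _ with v , v∈ , uv , v≢ , _ ← escape u∈ (ρ b) (ρ b) =
      v , v∈ , uv , λ { (here eq) → v≢ (sym eq) }
    escape′ u∈ ρ (b ∷ c ∷ []) _ with v , v∈ , uv , v≢b , v≢c ← escape u∈ (ρ b) (ρ c) =
      v , v∈ , uv , λ { (here eq) → v≢b (sym eq) ; (there (here eq)) → v≢c (sym eq) }
    escape′ u∈ ρ (_ ∷ _ ∷ _ ∷ _) (s≤s (s≤s ()))

    -- Either `e` has a neighbour in `U` not recorded so far, which by `inside` lies on `l` or
    -- settles the claim, or all its neighbours in `U` are known and `e` may be closed.
    closesBy : ∀ {s e} → Head s e → Complete s e → NewNeighbour s e → Placed s e → Closes s
    closesBy {s} {e} hd cc nn pl {ρ} p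
      with Any.any? (λ v → adj? G (ρ e) v ×-dec ¬? (Any.any? (λ b → ρ b Fin.≟ v) (nbrs s e))) U
    ... | yes some with v , v∈U , fresh ← find some with inside perm lk v∈U (proj₁ fresh)
      where
      perm = proj₁ (proj₂ (hd p))
      lk   = proj₂ (proj₂ (hd p))
    ...   | inj₁ v∈l = nn p v∈l fresh
    ...   | inj₂ res = res
    closesBy {s} {e} hd (inj₂ c) nn pl {ρ} p | no none = c (sat (isEnd p) (matches p) record
      { isChord  = isChord (facts p)
      ; distinct = distinct (facts p)
      ; complete = (λ v∈ uv → decidable-stable (Any.any? (λ b → ρ b Fin.≟ _) (nbrs s e))
                                λ new → none (lose v∈ (uv , new))) ∷ complete (facts p) })
    closesBy {s} {e} hd (inj₁ ≤2) nn pl {ρ} p | no none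
      with v , v∈ , uv , new ← escape′ (l⊆U (Matches-names (matches p) (Placed.onPath pl))) ρ (nbrs s e) ≤2 =
      contradiction (lose v∈ (uv , new)) none

    expand : ∀ {s e} → Head s e → Placed s e → Maybe (Closes s)
    expand {s} {e} hd pl =
      completed s e >>= λ cc → newNeighbour s e pl >>= λ nn → just (closesBy hd cc nn pl)

  -- Cliques and reducible configurations.

  findClique : ∀ s → Maybe (Closes s)
  findClique s =
    firstJust (map proj₁ (closed s)) λ a _ → firstJust (nbrs s a) λ b ab → firstJust (nbrs s a) λ c ac →
    dec⇒maybe (c ∈? nbrs s b) >>= λ bc → firstJust (nbrs s a) λ d ad →
    dec⇒maybe (d ∈? nbrs s b) >>= λ bd → dec⇒maybe (d ∈? nbrs s c) >>= λ cd →
    just λ {ρ} p → ⊥-elim (noK4 (clique G (ρ a ∷ ρ b ∷ ρ c ∷ [ ρ d ])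
      ((nbrs-adj p ab ∷ nbrs-adj p ac ∷ nbrs-adj p ad ∷ [])
        ∷ (nbrs-adj p bc ∷ nbrs-adj p bd ∷ []) ∷ (nbrs-adj p cd ∷ []) ∷ [] ∷ [])))

  ProperOff : State → List ℕ → (ℕ → Colour) → Set
  ProperOff s ts f = ∀ {x y} → x ∈ names (path s) → y ∈ names (path s) → x ∉ ts → y ∉ ts →
                     y ∈ nbrs s x → f x ≢ f y

  reduce : ∀ s {tN cl} → All (λ (t , N) → (t , N) ∈ closed s × t ∈ names (path s) × All (_∈ names (path s)) N) (tN ∷ cl) →
           (∀ f → ProperOff s (map proj₁ (tN ∷ cl)) f → Extends (tN ∷ cl) f) → Closes s
  reduce s {tN} {cl} known ext {ρ} p =
    recolour G U (map ρ ts) smaller (l⊆U (Matches-names (matches p) (proj₁ (proj₂ (All.head known))))) (here refl) new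
    where
    ts = map proj₁ (tN ∷ cl)
    ts⊆ : ∀ {t} → t ∈ ts → t ∈ names (path s)
    ts⊆ t∈ with _ , tN∈ , refl ← ∈-map⁻ proj₁ t∈ = proj₁ (proj₂ (All.lookup known tN∈))
    inj : ∀ {a b} → a ∈ names (path s) → b ∈ names (path s) → ρ a ≡ ρ b → a ≡ b
    inj = Matches-injective (matches p) unique
    onU : ∀ {a} → a ∈ names (path s) → ρ a ∈ U
    onU = l⊆U ∘ Matches-names (matches p)
    out : ∀ {x} → x ∈ names (path s) → x ∉ ts → ρ x ∉ map ρ ts
    out x∈ x∉ ρx∈ with _ , t∈ , eq ← ∈-map⁻ ρ ρx∈ = x∉ (subst (_∈ ts) (sym (inj x∈ (ts⊆ t∈) eq)) t∈)
    new : ∀ c → ProperOutside G U (map ρ ts) c → Recolouring G U (map ρ ts) c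
    new c outside = c′ , off , on
      where
      E = ext (c ∘ ρ) λ x∈ y∈ x∉ y∉ xy →
            outside (onU x∈) (out x∈ x∉) (onU y∈) (out y∈ y∉) (nbrs-adj p xy)
      h = proj₁ E
      c′ : V → Colour
      c′ v with Any.any? (λ t → ρ t Fin.≟ v) ts
      ... | yes t = h (Any.lookup t)
      ... | no  _ = c v
      off : ∀ {x} → x ∉ map ρ ts → c′ x ≡ c x
      off {x} x∉ with Any.any? (λ t → ρ t Fin.≟ x) ts
      ... | yes t = contradiction (Any.map⁺ (Any.map sym t)) x∉
      ... | no  _ = refl
      named-colour : ∀ {x} → x ∈ names (path s) → c′ (ρ x) ≡ h x
      named-colour {x} x∈ with Any.any? (λ t → ρ t Fin.≟ ρ x) ts
      ... | yes t = cong h (inj (ts⊆ (∈-lookup (Any.index t))) x∈ (Any.lookup-index t))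
      ... | no ¬t = sym (proj₁ (proj₂ E) λ x∈ts → ¬t (lose x∈ts refl))
      on : ∀ {x y} → x ∈ U → x ∈ map ρ ts → y ∈ U → x ~ y → c′ x ≢ c′ y
      on x∈ x∈T y∈ xy eq with _ , t∈ , refl ← ∈-map⁻ ρ x∈T with (t , N) , tN∈ , refl ← ∈-map⁻ proj₁ t∈
        with tN∈cl , t∈ns , N⊆ ← All.lookup known tN∈
        with z , z∈ , refl ← find (All.lookup (complete (facts p)) tN∈cl y∈ xy) =
        All.lookup (All.lookup (proj₂ (proj₂ E)) tN∈) z∈
          (trans (sym (named-colour t∈ns)) (trans eq (named-colour (All.lookup N⊆ z∈))))

  -- All closed vertices are deleted together. Their remaining neighbours form `outer`, and each
  -- colouring of `outer` has to extend.
  findExtension : ∀ s → Maybe (Closes s)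
  findExtension s with closed s in eq
  ... | [] = nothing
  ... | cl@(_ ∷ _) =
    dec⇒maybe (All.all? (λ (t , N) → t ∈? ns ×-dec All.all? (_∈? ns) N) cl) >>= λ cl⊆ →
    extensions cl outer [] >>= λ ext →
    just (reduce s (All.tabulate λ tN∈ → subst (_ ∈_) (sym eq) tN∈ , All.lookup cl⊆ tN∈) λ f _ → ext f [])
    where
    ns    = names (path s)
    outer = filter (λ y → ¬? (y ∈? map proj₁ cl) ×-dec Any.any? (λ (_ , N) → y ∈? N) cl) ns

  -- After deletion of `t`, the colour of `b` is free for `t`: every neighbour of `t` is also
  -- adjacent to `b` and so coloured differently.
  findDominated : ∀ s → Maybe (Closes s)
  findDominated s = firstJust (closed s) λ (t , N) tN∈ → firstJust ns λ b b∈ →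
    dec⇒maybe (¬? (b ℕ.≟ t)) >>= λ b≢t →
    dec⇒maybe (All.all? (_∈? nbrs s b) N) >>= λ N⊆ →
    dec⇒maybe (t ∈? ns) >>= λ t∈ns →
    dec⇒maybe (All.all? (λ y → ¬? (y ℕ.≟ t) ×-dec y ∈? ns) N) >>= λ N⊆ns →
    just (reduce s ((tN∈ , t∈ns , All.map proj₂ N⊆ns) ∷ []) (dominated b∈ b≢t N⊆ N⊆ns))
    where
    ns = names (path s)
    dominated : ∀ {t N b} → b ∈ ns → b ≢ t → All (_∈ nbrs s b) N → All (λ y → y ≢ t × y ∈ ns) N →
                ∀ f → ProperOff s [ t ] f → Extends [ t , N ] f
    dominated {t} {N} {b} b∈ b≢t N⊆ N⊆ns f proper = h , (λ x∉ → h-other λ { refl → x∉ (here refl) }) ,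
      All.tabulate (λ {y} y∈ eq → let y≢t , y∈ns = All.lookup N⊆ns y∈ in
        proper b∈ y∈ns (λ { (here refl) → b≢t refl }) (λ { (here refl) → y≢t refl }) (All.lookup N⊆ y∈)
          (trans (sym h-t) (trans eq (h-other y≢t)))) ∷ []
      where
      h : ℕ → Colour
      h x with x ℕ.≟ t
      ... | yes _ = f b
      ... | no  _ = f x
      h-t : h t ≡ f b
      h-t with t ℕ.≟ t
      ... | yes _   = refl
      ... | no t≢t = contradiction refl t≢t
      h-other : ∀ {x} → x ≢ t → h x ≡ f x
      h-other {x} x≢t with x ℕ.≟ t
      ... | yes x≡t = contradiction x≡t x≢t
      ... | no  _   = refl

  -- The case analysis.

  -- Heads with fewer than three known neighbours come first: they force a further chord. The edges
  -- are passed as an argument E so that they are evaluated only once.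
  unclosedHead : ∀ s → Maybe (∃ (Head s))
  unclosedHead s = choose (edges s) refl
    where
    preferred : List (ℕ × ℕ) → List (∃ (Head s)) → Maybe (∃ (Head s))
    preferred E hs = head (filterᵇ (λ (e , _) → length (incident e E) ℕ.<ᵇ 3) hs) <∣> head hs
    choose : ∀ E → E ≡ edges s → Maybe (∃ (Head s))
    choose E eq = preferred E (filterᵇ (λ (e , _) → not (does (e ∈? map proj₁ (closed s))))
      (heads E eq 4 (path s) λ p → l , matches p , ↭-refl , good))

  -- The constants 4 (length of the rotation sequences tried) and 20 (depth of the case analysis)
  -- were found by experiment.
  solve : ℕ → ∀ s → Maybe (Closes s)
  solve zero    s = nothing
  solve (suc k) s@(⟨ o , t , X , cl ⟩) =
    -- A rotation turns a path neighbour of a chord end or of `w` into the head. Gaps beside these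
    -- vertices and beside the first one are resolved before heads are sought.
    orSplit (o ∷ concatMap (λ (a , b) → a ∷ [ b ]) X ++ Maybe.maybe′ [_] [] (firstName t))
      (Maybe.maybe′
        -- Gaps beside `e` are resolved first because `place` requires both cycle neighbours of `e`
        -- to be named.
        (λ (e , hd) → orSplit [ e ] (place s e >>= λ pl → Expansion.expand (solve k) hd pl))
        -- All heads found are closed, so their known neighbourhoods must give a reduction or a K₄.
        (findDominated s <∣> findClique s <∣> findExtension s)
        (unclosedHead s))
    where
    firstName : Word → Maybe ℕ
    firstName []      = nothing
    firstName (x ∷ _) = x
    orSplit : List ℕ → Maybe (Closes s) → Maybe (Closes s)
    orSplit W other with gapBeside W t
    ... | just g  = solve k (without o X cl g) >>= λ c₁ → solve k (exposed o X cl g) >>= λ c₂ →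
                    just (closes-split o X cl g c₁ c₂)
    ... | nothing = other

  -- Here `0` names `h` and `1` names `w`; nothing is known beyond the path and the closing edge.
  start : State
  start = ⟨ 1 , just 0 ∷ nothing ∷ [ just 1 ] , [] , [] ⟩

  -- The search runs during type checking. Its decisions depend on names only, so it evaluates for a
  -- variable setting `S` and covers all graphs at once.
  start-closes : Closes start
  start-closes = from-is-just (solve 20 start) refl

-- The extremal choice of path and cycle.

module LongestPath {n : ℕ} (G : Graph n) (noK4 : ¬ ContainsSubgraph G (K 4)) (U : List (Fin n))
  (escape  : ∀ {u} → u ∈ U → ∀ a b → ∃[ v ] v ∈ U × Adj G u v × v ≢ a × v ≢ b)
  (smaller : ∀ U′ → length U′ ℕ.< length U → Result G U′)
  where

  IsPath : List (Fin n) → Set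
  IsPath p = Unique p × Linked (Adj G) p × All (_∈ U) p

  infix 4 _∈V?_

  _∈V?_ : (v : Fin n) (p : List (Fin n)) → Dec (v ∈ p)
  v ∈V? p = Any.any? (v Fin.≟_) p

  prepend : ∀ {v h p} → v ∈ U → v ∉ h ∷ p → Adj G h v → IsPath (h ∷ p) → IsPath (v ∷ h ∷ p)
  prepend v∈U v∉ hv (up , lp , p⊆U) = All.¬Any⇒All¬ _ v∉ ∷ up , symmetric G hv ∷ lp , v∈U ∷ p⊆U

  mutual

    -- The extremal choice is a lexicographic recursion: `k` bounds the number of vertices off the
    -- path, and `m` the length of the part `r` behind the cycle. `longer` lowers `k`; `widen` keeps
    -- `k` and lowers `m`.
    fromPath : ∀ k {h x p} → IsPath (h ∷ x ∷ p) → n ≤ k + length (h ∷ x ∷ p) → Result G U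
    fromPath k {h} {x} {p} isP@(up , lp , h∈U ∷ _) n≤
      -- A neighbour of `h` other than its successor `x` either prolongs the path or closes a cycle
      -- of length at least three.
      with v , v∈U , hv , v≢x , _ ← escape h∈U x x with v ∈V? p
    ... | no v∉p = longer k v∈U (λ { (here refl) → loopless G refl hv ; (there (here v≡x)) → v≢x v≡x
                                   ; (there (there v∈p)) → v∉p v∈p }) hv isP n≤
    ... | yes v∈p with A , r , refl ← ∈-∃++ v∈p =
      fromCycle k (length r) {q = x ∷ A} (subst IsPath (sym eq) isP) (s≤s z≤n) hv
        (subst (λ p → n ≤ k + length p) (sym eq) n≤) ℕ.≤-refl
      where
      eq : (h ∷ x ∷ A ∷ʳ v) ++ r ≡ h ∷ x ∷ A ++ v ∷ r
      eq = List.++-assoc (h ∷ x ∷ A) [ v ] r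

    longer : ∀ k {v h x p} → v ∈ U → v ∉ h ∷ x ∷ p → Adj G h v → IsPath (h ∷ x ∷ p) →
             n ≤ k + length (h ∷ x ∷ p) → Result G U
    longer zero v∈U v∉ hv isP n≤ =
      contradiction (Unique-length (proj₁ (prepend v∈U v∉ hv isP))) (ℕ.<⇒≱ (s≤s n≤))
    longer (suc k) v∈U v∉ hv isP n≤ =
      fromPath k (prepend v∈U v∉ hv isP) (subst (n ≤_) (sym (ℕ.+-suc k _)) n≤)

    fromCycle : ∀ k m {h q w r} → IsPath ((h ∷ q ∷ʳ w) ++ r) → 1 ≤ length q → Adj G h w →
                n ≤ k + length ((h ∷ q ∷ʳ w) ++ r) → length r ≤ m → Result G U
    fromCycle k m {h} {q} {w} {r} isP@(up , lp , p⊆U) 1≤q hw n≤ r≤ = Search.start-closes setting {ρ} record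
      { isEnd   = refl
      ; matches = name refl (gap q)
      ; facts   = record { isChord = [] ; distinct = [] ; complete = [] }
      }
      where
      unique : Unique (h ∷ q ∷ʳ w)
      unique = AllPairs-++⁻ˡ (h ∷ q ∷ʳ w) up
      linked : Linked (Adj G) (h ∷ q ∷ʳ w)
      linked = Linked-++⁻ˡ (h ∷ q ∷ʳ w) lp
      open ClosedPath G unique linked hw 1≤q
      ρ : ℕ → Fin n
      ρ zero    = h
      ρ (suc _) = w
      gap : ∀ q → Matches ρ (nothing ∷ [ just 1 ]) (q ∷ʳ w)
      gap []      = stop (name refl [])
      gap (_ ∷ q) = skip (gap q)
      permuted : ∀ {a} → a ↭ l → Linked (Adj G) (a ++ r) → IsPath (a ++ r)
      permuted p lk = let q = Perm.++⁺ʳ r (↭-sym p) in Unique-resp-↭ q up , lk , Perm.All-resp-↭ q p⊆U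
      n≤′ : ∀ {a} → a ↭ l → n ≤ k + length (a ++ r)
      n≤′ p = subst (λ x → n ≤ k + x) (sym (Perm.↭-length (Perm.++⁺ʳ r p))) n≤
      inside : ∀ {u a v} → u ∷ a ↭ l → Linked (Adj G) (u ∷ a ++ r) → v ∈ U → Adj G u v → v ∈ l ⊎ Result G U
      inside {u} {a} {v} perm lk v∈U uv with v ∈V? l | v ∈V? r
      ... | yes v∈l | _       = inj₁ v∈l
      ... | no  _   | yes v∈r = inj₂ (widen k m perm (permuted perm lk) uv v∈r (n≤′ perm) r≤)
      -- `longer` applies to paths with at least two vertices; a rearrangement of `l` has that many
      -- by its length.
      inside {u} {[]} perm lk v∈U uv | no _ | no _ = contradiction (ℕ.suc-injective (Perm.↭-length perm))
        (subst (0 ≢_) (sym (List.length-++-sucʳ q w [])) λ ())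
      inside {u} {x ∷ a} perm lk v∈U uv | no v∉l | no v∉r =
        inj₂ (longer k v∈U (λ v∈ → [ v∉l ∘ Perm.∈-resp-↭ perm , v∉r ]′ (∈-++⁻ (u ∷ x ∷ a) v∈)) uv
               (permuted perm lk) (n≤′ perm))
      setting : Setting
      setting = record
        { G = G ; U = U ; C = cycle ; unique = unique ; onCycle = onCycle ; follows = follows
        ; good = lp ; l⊆U = λ v∈ → All.lookup p⊆U (∈-++⁺ˡ v∈) ; escape = escape ; smaller = smaller
        ; noK4 = noK4 ; inside = inside }

    -- Closing the rearranged path at `v` instead absorbs the stretch `B` before `v` into the cycle
    -- and leaves `r′`, which is shorter than `r`.
    widen : ∀ k m {h w r u a v} {q : List (Fin n)} → u ∷ a ↭ h ∷ q ∷ʳ w → IsPath (u ∷ a ++ r) → Adj G u v →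
            v ∈ r → n ≤ k + length (u ∷ a ++ r) → length r ≤ m → Result G U
    widen k m {u = u} {a} {v} {q} perm isP uv v∈r n≤ r≤ with B , r′ , refl ← ∈-∃++ v∈r | m
    ... | zero  = contradiction r≤ (subst (λ x → ¬ x ≤ 0) (sym (List.length-++-sucʳ B v r′)) λ ())
    ... | suc m =
      fromCycle k m {q = a ++ B} (subst IsPath (sym eq) isP)
        (ℕ.≤-trans 1≤a (List.length-++-≤ˡ a)) uv (subst (λ p → n ≤ k + length p) (sym eq) n≤)
        (ℕ.≤-trans (List.length-++-≤ʳ r′ {B})
                   (ℕ.≤-pred (subst (_≤ suc m) (List.length-++-sucʳ B v r′) r≤)))
      where
      1≤a : 1 ≤ length a
      1≤a = subst (1 ≤_) (sym (trans (ℕ.suc-injective (Perm.↭-length perm)) (List.length-++-sucʳ q _ []))) (s≤s z≤n)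
      eq : (u ∷ (a ++ B) ∷ʳ v) ++ r′ ≡ u ∷ a ++ B ++ v ∷ r′
      eq = cong (u ∷_) (trans (List.++-assoc (a ++ B) [ v ] r′) (List.++-assoc a B (v ∷ r′)))

-- Vertices of low degree, and the conclusion.

freeColour : (x y : Colour) → ∃[ z ] z ≢ x × z ≢ y
freeColour x y with Fin.any? (λ z → ¬? (z Fin.≟ x) ×-dec ¬? (z Fin.≟ y))
... | yes z = z
... | no ¬z = contradiction (free x y) ¬z
  where
  free : ∀ x y → ∃[ z ] z ≢ x × z ≢ y
  free zero             zero             = suc zero , (λ ()) , (λ ())
  free zero             (suc zero)       = suc (suc zero) , (λ ()) , (λ ())
  free zero             (suc (suc zero)) = suc zero , (λ ()) , (λ ())
  free (suc zero)       zero             = suc (suc zero) , (λ ()) , (λ ())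
  free (suc zero)       (suc _)          = zero , (λ ()) , (λ ())
  free (suc (suc zero)) zero             = suc zero , (λ ()) , (λ ())
  free (suc (suc zero)) (suc _)          = zero , (λ ()) , (λ ())

module _ {n : ℕ} (G : Graph n) (noK4 : ¬ ContainsSubgraph G (K 4)) where

  -- Degree at most two within `U`: `a` and `b` may coincide, and neither has to be a neighbour of
  -- `u`.
  LowDegree : List (Fin n) → Fin n → Set
  LowDegree U u = ∃₂ λ a b → All (λ v → Adj G u v → v ≡ a ⊎ v ≡ b) U

  lowDegree? : ∀ U u → Dec (LowDegree U u)
  lowDegree? U u = Fin.any? λ a → Fin.any? λ b →
    All.all? (λ v → adj? G u v →-dec (v Fin.≟ a ⊎-dec v Fin.≟ b)) U

  removeLow : ∀ {U u} → u ∈ U → LowDegree U u → (∀ U′ → length U′ ℕ.< length U → Result G U′) → Result G U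
  removeLow {U} {u} u∈U (a , b , low) smaller =
    recolour G U [ u ] smaller u∈U (here refl) λ c _ → patch c , patch-off c , λ x∈ x∈T → patch-on c x∈ x∈T
    where
    patch : (Fin n → Colour) → Fin n → Colour
    patch c v with v Fin.≟ u
    ... | yes _ = proj₁ (freeColour (c a) (c b))
    ... | no  _ = c v
    patch-off : ∀ c {x} → x ∉ [ u ] → patch c x ≡ c x
    patch-off c {x} x∉ with x Fin.≟ u
    ... | yes x≡u = contradiction (here x≡u) x∉
    ... | no  _   = refl
    patch-on : ∀ c {x y} → x ∈ U → x ∈ [ u ] → y ∈ U → Adj G x y → patch c x ≢ patch c y
    patch-on c {y = y} _ (here refl) y∈ uy with u Fin.≟ u | y Fin.≟ u
    ... | no u≢u | _        = contradiction refl u≢u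
    ... | yes _  | yes refl = contradiction uy (loopless G refl)
    ... | yes _  | no _ with All.lookup low y∈ uy
    ...   | inj₁ refl = proj₁ (proj₂ (freeColour (c a) (c b)))
    ...   | inj₂ refl = proj₂ (proj₂ (freeColour (c a) (c b)))

  -- Induction on the size of `U` replaces the minimal counterexample. If no vertex of low degree
  -- can be removed, `escape` holds and the path argument applies.
  result : ∀ k U → length U ≤ k → Result G U
  result k       []        _  = inj₂ ((λ _ → zero) , λ ())
  result (suc k) U@(u ∷ _) U≤ with Any.any? (lowDegree? U) U
  ... | yes low = let _ , v∈ , lowv = find low in removeLow v∈ lowv smaller
    where
    smaller : ∀ U′ → length U′ ℕ.< length U → Result G U′
    smaller U′ U′< = result k U′ (ℕ.≤-pred (ℕ.≤-trans U′< U≤))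
  -- Any edge at `u` serves as the initial path, and `n` as the initial bound on the vertices off
  -- it.
  ... | no high = let v , v∈U , uv , _ = escape (here refl) u u in
    LongestPath.fromPath G noK4 U escape smaller n
      (((λ u≡v → loopless G u≡v uv) ∷ []) ∷ [] ∷ [] , uv ∷ [-] , here refl ∷ v∈U ∷ []) (ℕ.m≤m+n n _)
    where
    smaller : ∀ U′ → length U′ ℕ.< length U → Result G U′
    smaller U′ U′< = result k U′ (ℕ.≤-pred (ℕ.≤-trans U′< U≤))
    escape : ∀ {u} → u ∈ U → ∀ a b → ∃[ v ] v ∈ U × Adj G u v × v ≢ a × v ≢ b
    escape {u} u∈ a b with Any.any? (λ v → adj? G u v ×-dec ¬? (v Fin.≟ a) ×-dec ¬? (v Fin.≟ b)) U
    ... | yes some = find some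
    ... | no none = contradiction (lose u∈ (a , b , All.tabulate near)) high
      where
      near : ∀ {v} → v ∈ U → Adj G u v → v ≡ a ⊎ v ≡ b
      near {v} v∈ uv with v Fin.≟ a | v Fin.≟ b
      ... | yes v≡a | _       = inj₁ v≡a
      ... | no _    | yes v≡b = inj₂ v≡b
      ... | no v≢a  | no v≢b  = contradiction (lose v∈ (uv , v≢a , v≢b)) none

proposition1p13 : (n : ℕ) (G : Graph n) → χ G ≥ 4 → ¬ ContainsSubgraph G (K 4) → Σ[ C ∈ Cycle G ] HasAtLeastChords C 4
proposition1p13 n G χ≥4 noK4 with result G noK4 (length (allFin n)) (allFin n) ℕ.≤-refl
... | inj₁ goal = goal
... | inj₂ (c , proper) = contradiction
  (proj₂ (proj₂ (chromaticNumber G)) 3 (c , λ u v → proper (∈-allFin u) (∈-allFin v))) (ℕ.<⇒≱ χ≥4)
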